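{- Over $\mathrm{HA}^\omega$, the dependent explicitly controlled product of selection functions $\mathsf{EPS}$ is $T$-definable from the simple explicitly controlled product of selection functions $\mathsf{eps}$; that is, $\mathsf{eps}\geq_T\mathsf{EPS}$.
   Context: Types and systems. Finite types are generated from $\mathbb{B}$ (booleans) and $\mathbb{N}$ by $X\times Y$, $X\to Y$ and $X^*$ (finite sequences). For a sequence of types $(X_i)_{i\in\mathbb{N}}$, $\Pi_i X_i$ is the type of infinite sequences whose $i$-th entry is in $X_i$ and $\Pi_{i<n}X_i$ the type of finite sequences of length $n$. (This is used for readability; one may take all $X_i$ equal to one type $X$, reading $\Pi_iX_i$ as $\mathbb{N}\to X$ and finite sequence types as $X^*$.) $\mathrm{HA}^\omega$ is Heyting arithmetic in all finite types with fully extensional equality (Troelstra's E-$\mathrm{HA}^\omega$); system $T$ is its quantifier-free fragment (Gödel's primitive recursive functionals). $\mathbf{0}$ denotes the canonical zero object of each type (the zero sequence for sequence types, the constant zero function for function types). Notation. $*$ is concatenation; $|s|$ is the length of $s$; $q_x(\alpha)=q(x*\alpha)$. $J_RX=(X\to R)\to X$. $T$-definability. A functional is specified by a defining equation (for each choice of type parameters). $G$ is $T$-definable from $F$ over a theory $\mathcal{S}$ (written $F\ge_T G$) if for each choice of types for $G$ there are a choice of types for $F$ and a term $s$ of system $T$ such that $s(F)$ satisfies the defining equation of $G$, provably in $\mathcal{S}$ together with the defining equation of $F$. $\mathsf{eps}$. For $\varepsilon\colon\Pi_kJ_RX_k$, $\ell\colon R\to\mathbb{N}$, $q\colon\Pi_iX_{i+n}\to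 R$, the value $\mathsf{eps}^\ell_n(\varepsilon)(q)\colon\Pi_iX_{i+n}$ is specified by: $\mathsf{eps}^\ell_n(\varepsilon)(q)=\mathbf{0}$ if $\ell(q(\mathbf{0}))<n$, and otherwise $\mathsf{eps}^\ell_n(\varepsilon)(q)=c*\mathsf{eps}^\ell_{n+1}(\varepsilon)(q_c)$, where $c=\varepsilon_n(\lambda x.\,q_x(\mathsf{eps}^\ell_{n+1}(\varepsilon)(q_x)))$. $\mathsf{EPS}$. For $\varepsilon\colon\Pi_k(\Pi_{i<k}X_i\to J_RX_k)$ (so $\varepsilon_s\colon J_RX_{|s|}$ for a finite sequence $s\colon\Pi_{i<|s|}X_i$), $\ell\colon R\to\mathbb{N}$, $q\colon\Pi_iX_{|s|+i}\to R$, the value $\mathsf{EPS}^\ell_s(\varepsilon)(q)\colon\Pi_iX_{|s|+i}$ is specified by: $\mathsf{EPS}^\ell_s(\varepsilon)(q)=\mathbf{0}$ if $\ell(q(\mathbf{0}))<|s|$, and otherwise $\mathsf{EPS}^\ell_s(\varepsilon)(q)=c*\mathsf{EPS}^\ell_{s*c}(\varepsilon)(q_c)$, where $c=\varepsilon_s(\lambda x.\,q_x(\mathsf{EPS}^\ell_{s*x}(\varepsilon)(q_x)))$. -}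

module Defs where

open import Data.List using (List; []; _∷_; map)
open import Data.List.Membership.Propositional using (_∈_)
open import Data.List.Relation.Unary.Any using (here; there)
open import Data.Product using (_×_; _,_; Σ-syntax; ∃-syntax)
open import Function using (_∘_)
open import Relation.Binary.PropositionalEquality using (refl)

infixr 7 _⇒_
infixr 8 _⊗_
infix  9 _⋆
infixl 9 _·_
infix  5 _≐_
infixr 4 _∧_
infixr 3 _∨_
infixr 2 _⊃_
infix  1 _⊢_

------------------------------------------------------------------------
-- Finite types

data Ty : Set where
  𝔹 ℕ : Ty
  _⊗_ _⇒_ : Ty → Ty → Ty
  _⋆ : Ty → Ty

-- Infinite sequences, i.e. Π_i X_i with all X_i equal to X.
Seq : Ty → Ty
Seq X = ℕ ⇒ X

J : Ty → Ty → Ty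
J R X = (X ⇒ R) ⇒ X

Ctx : Set
Ctx = List Ty

variable
  A B C X R : Ty
  Γ Δ : Ctx

------------------------------------------------------------------------
-- Terms of system T
--
-- Finite sequences are generated from the empty one by s , x ↦ s * x,
-- so `snoc` appends an entry at the end.

data Tm (Γ : Ctx) : Ty → Set where
  var     : A ∈ Γ → Tm Γ A
  ƛ       : Tm (A ∷ Γ) B → Tm Γ (A ⇒ B)
  _·_     : Tm Γ (A ⇒ B) → Tm Γ A → Tm Γ B
  pair    : Tm Γ A → Tm Γ B → Tm Γ (A ⊗ B)
  fst     : Tm Γ (A ⊗ B) → Tm Γ A
  snd     : Tm Γ (A ⊗ B) → Tm Γ B
  true    : Tm Γ 𝔹
  false   : Tm Γ 𝔹
  if      : Tm Γ 𝔹 → Tm Γ A → Tm Γ A → Tm Γ A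
  zero    : Tm Γ ℕ
  suc     : Tm Γ ℕ → Tm Γ ℕ
  natrec  : Tm Γ A → Tm Γ (ℕ ⇒ A ⇒ A) → Tm Γ ℕ → Tm Γ A
  nil     : Tm Γ (A ⋆)
  snoc    : Tm Γ (A ⋆) → Tm Γ A → Tm Γ (A ⋆)
  listrec : Tm Γ B → Tm Γ (A ⋆ ⇒ A ⇒ B ⇒ B) → Tm Γ (A ⋆) → Tm Γ B

Ren Sub : Ctx → Ctx → Set
Ren Γ Δ = ∀ {A} → A ∈ Γ → A ∈ Δ
Sub Γ Δ = ∀ {A} → A ∈ Γ → Tm Δ A

liftr : Ren Γ Δ → Ren (A ∷ Γ) (A ∷ Δ)
liftr ρ (here refl) = here refl
liftr ρ (there x)   = there (ρ x)

ren : Ren Γ Δ → Tm Γ A → Tm Δ A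
ren ρ (var x)         = var (ρ x)
ren ρ (ƛ t)           = ƛ (ren (liftr ρ) t)
ren ρ (t · u)         = ren ρ t · ren ρ u
ren ρ (pair t u)      = pair (ren ρ t) (ren ρ u)
ren ρ (fst t)         = fst (ren ρ t)
ren ρ (snd t)         = snd (ren ρ t)
ren ρ true            = true
ren ρ false           = false
ren ρ (if b t u)      = if (ren ρ b) (ren ρ t) (ren ρ u)
ren ρ zero            = zero
ren ρ (suc t)         = suc (ren ρ t)
ren ρ (natrec a f n)  = natrec (ren ρ a) (ren ρ f) (ren ρ n)
ren ρ nil             = nil
ren ρ (snoc s t)      = snoc (ren ρ s) (ren ρ t)
ren ρ (listrec a f s) = listrec (ren ρ a) (ren ρ f) (ren ρ s)

wk : Tm Γ A → Tm (B ∷ Γ) A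
wk = ren there

-- Substitute t for the most recent variable and σ for the others.
_▸_ : Sub Γ Δ → Tm Δ A → Sub (A ∷ Γ) Δ
(σ ▸ t) (here refl) = t
(σ ▸ t) (there x)   = σ x

lifts : Sub Γ Δ → Sub (A ∷ Γ) (A ∷ Δ)
lifts σ = (wk ∘ σ) ▸ var (here refl)

sub : Sub Γ Δ → Tm Γ A → Tm Δ A
sub σ (var x)         = σ x
sub σ (ƛ t)           = ƛ (sub (lifts σ) t)
sub σ (t · u)         = sub σ t · sub σ u
sub σ (pair t u)      = pair (sub σ t) (sub σ u)
sub σ (fst t)         = fst (sub σ t)
sub σ (snd t)         = snd (sub σ t)
sub σ true            = true
sub σ false           = false
sub σ (if b t u)      = if (sub σ b) (sub σ t) (sub σ u)
sub σ zero            = zero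
sub σ (suc t)         = suc (sub σ t)
sub σ (natrec a f n)  = natrec (sub σ a) (sub σ f) (sub σ n)
sub σ nil             = nil
sub σ (snoc s t)      = snoc (sub σ s) (sub σ t)
sub σ (listrec a f s) = listrec (sub σ a) (sub σ f) (sub σ s)

_[_] : Tm (A ∷ Γ) B → Tm Γ A → Tm Γ B
t [ u ] = sub (var ▸ u) t

closed : Tm [] A → Tm Γ A
closed = ren λ ()

v0 : Tm (A ∷ Γ) A
v0 = var (here refl)

v1 : Tm (B ∷ A ∷ Γ) A
v1 = wk v0

v2 : Tm (C ∷ B ∷ A ∷ Γ) A
v2 = wk v1

v3 : Tm (X ∷ C ∷ B ∷ A ∷ Γ) A
v3 = wk v2

v4 : Tm (R ∷ X ∷ C ∷ B ∷ A ∷ Γ) A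
v4 = wk v3

------------------------------------------------------------------------
-- Formulas and derivations of HAω

data Formula (Γ : Ctx) : Set where
  _≐_         : Tm Γ A → Tm Γ A → Formula Γ
  falsum      : Formula Γ
  _∧_ _∨_ _⊃_ : Formula Γ → Formula Γ → Formula Γ
  all ex      : Formula (A ∷ Γ) → Formula Γ

renF : Ren Γ Δ → Formula Γ → Formula Δ
renF ρ (t ≐ u) = ren ρ t ≐ ren ρ u
renF ρ falsum  = falsum
renF ρ (φ ∧ ψ) = renF ρ φ ∧ renF ρ ψ
renF ρ (φ ∨ ψ) = renF ρ φ ∨ renF ρ ψ
renF ρ (φ ⊃ ψ) = renF ρ φ ⊃ renF ρ ψ
renF ρ (all φ) = all (renF (liftr ρ) φ)
renF ρ (ex φ)  = ex (renF (liftr ρ) φ)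

wkF : Formula Γ → Formula (A ∷ Γ)
wkF = renF there

subF : Sub Γ Δ → Formula Γ → Formula Δ
subF σ (t ≐ u) = sub σ t ≐ sub σ u
subF σ falsum  = falsum
subF σ (φ ∧ ψ) = subF σ φ ∧ subF σ ψ
subF σ (φ ∨ ψ) = subF σ φ ∨ subF σ ψ
subF σ (φ ⊃ ψ) = subF σ φ ⊃ subF σ ψ
subF σ (all φ) = all (subF (lifts σ) φ)
subF σ (ex φ)  = ex (subF (lifts σ) φ)

_[_]F : Formula (A ∷ Γ) → Tm Γ A → Formula Γ
φ [ t ]F = subF (var ▸ t) φ

-- Natural deduction for E-HAω: intuitionistic logic, equality at every
-- type with Leibniz's rule and extensionality, the conversion rules of
-- system T, the Peano axioms and induction for 𝔹, ℕ and finite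
-- sequences.  Disjointness of the constructors of 𝔹 and of _⋆ follows
-- from zero≠suc by means of `if` and `listrec`.

data _⊢_ : List (Formula Γ) → Formula Γ → Set where

  hyp : {H : List (Formula Γ)} {φ : Formula Γ} → φ ∈ H → H ⊢ φ

  ⊥E  : {H : List (Formula Γ)} {φ : Formula Γ} → H ⊢ falsum → H ⊢ φ
  ∧I  : {H : List (Formula Γ)} {φ ψ : Formula Γ} → H ⊢ φ → H ⊢ ψ → H ⊢ φ ∧ ψ
  ∧E₁ : {H : List (Formula Γ)} {φ ψ : Formula Γ} → H ⊢ φ ∧ ψ → H ⊢ φ
  ∧E₂ : {H : List (Formula Γ)} {φ ψ : Formula Γ} → H ⊢ φ ∧ ψ → H ⊢ ψ
  ∨I₁ : {H : List (Formula Γ)} {φ ψ : Formula Γ} → H ⊢ φ → H ⊢ φ ∨ ψ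
  ∨I₂ : {H : List (Formula Γ)} {φ ψ : Formula Γ} → H ⊢ ψ → H ⊢ φ ∨ ψ
  ∨E  : {H : List (Formula Γ)} {φ ψ χ : Formula Γ} →
        H ⊢ φ ∨ ψ → φ ∷ H ⊢ χ → ψ ∷ H ⊢ χ → H ⊢ χ
  ⊃I  : {H : List (Formula Γ)} {φ ψ : Formula Γ} → φ ∷ H ⊢ ψ → H ⊢ φ ⊃ ψ
  ⊃E  : {H : List (Formula Γ)} {φ ψ : Formula Γ} → H ⊢ φ ⊃ ψ → H ⊢ φ → H ⊢ ψ
  ∀I  : {H : List (Formula Γ)} {φ : Formula (A ∷ Γ)} → map wkF H ⊢ φ → H ⊢ all φ
  ∀E  : {H : List (Formula Γ)} {φ : Formula (A ∷ Γ)} →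
        H ⊢ all φ → (t : Tm Γ A) → H ⊢ φ [ t ]F
  ∃I  : {H : List (Formula Γ)} {φ : Formula (A ∷ Γ)} →
        (t : Tm Γ A) → H ⊢ φ [ t ]F → H ⊢ ex φ
  ∃E  : {H : List (Formula Γ)} {φ : Formula (A ∷ Γ)} {ψ : Formula Γ} →
        H ⊢ ex φ → φ ∷ map wkF H ⊢ wkF ψ → H ⊢ ψ

  ≐-refl  : {H : List (Formula Γ)} {t : Tm Γ A} → H ⊢ t ≐ t
  ≐-subst : {H : List (Formula Γ)} (φ : Formula (A ∷ Γ)) {t u : Tm Γ A} →
            H ⊢ t ≐ u → H ⊢ φ [ t ]F → H ⊢ φ [ u ]F
  ext     : {H : List (Formula Γ)} {f g : Tm Γ (A ⇒ B)} →
            H ⊢ all (wk f · v0 ≐ wk g · v0) → H ⊢ f ≐ g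

  β       : {H : List (Formula Γ)} {t : Tm (A ∷ Γ) B} {u : Tm Γ A} →
            H ⊢ ƛ t · u ≐ t [ u ]
  fst-β   : {H : List (Formula Γ)} {t : Tm Γ A} {u : Tm Γ B} →
            H ⊢ fst (pair t u) ≐ t
  snd-β   : {H : List (Formula Γ)} {t : Tm Γ A} {u : Tm Γ B} →
            H ⊢ snd (pair t u) ≐ u
  pair-η  : {H : List (Formula Γ)} {p : Tm Γ (A ⊗ B)} →
            H ⊢ pair (fst p) (snd p) ≐ p
  if-true      : {H : List (Formula Γ)} {t u : Tm Γ A} → H ⊢ if true t u ≐ t
  if-false     : {H : List (Formula Γ)} {t u : Tm Γ A} → H ⊢ if false t u ≐ u
  natrec-zero  : {H : List (Formula Γ)} {a : Tm Γ A} {f : Tm Γ (ℕ ⇒ A ⇒ A)} →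
                 H ⊢ natrec a f zero ≐ a
  natrec-suc   : {H : List (Formula Γ)} {a : Tm Γ A} {f : Tm Γ (ℕ ⇒ A ⇒ A)} {n : Tm Γ ℕ} →
                 H ⊢ natrec a f (suc n) ≐ f · n · natrec a f n
  listrec-nil  : {H : List (Formula Γ)} {b : Tm Γ B} {f : Tm Γ (A ⋆ ⇒ A ⇒ B ⇒ B)} →
                 H ⊢ listrec b f nil ≐ b
  listrec-snoc : {H : List (Formula Γ)} {b : Tm Γ B} {f : Tm Γ (A ⋆ ⇒ A ⇒ B ⇒ B)}
                 {s : Tm Γ (A ⋆)} {x : Tm Γ A} →
                 H ⊢ listrec b f (snoc s x) ≐ f · s · x · listrec b f s

  zero≠suc : {H : List (Formula Γ)} {n : Tm Γ ℕ} → H ⊢ (zero ≐ suc n) ⊃ falsum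
  suc-inj  : {H : List (Formula Γ)} {m n : Tm Γ ℕ} → H ⊢ (suc m ≐ suc n) ⊃ (m ≐ n)

  𝔹-ind : {H : List (Formula Γ)} (φ : Formula (𝔹 ∷ Γ)) →
          H ⊢ φ [ true ]F → H ⊢ φ [ false ]F → H ⊢ all φ
  ℕ-ind : {H : List (Formula Γ)} (φ : Formula (ℕ ∷ Γ)) →
          H ⊢ φ [ zero ]F →
          φ ∷ map wkF H ⊢ subF ((var ∘ there) ▸ suc v0) φ →
          H ⊢ all φ
  -- In the last premise the context is x : A, s : A ⋆, Γ.
  ⋆-ind : {H : List (Formula Γ)} (φ : Formula (A ⋆ ∷ Γ)) →
          H ⊢ φ [ nil ]F →
          wkF φ ∷ map wkF (map wkF H) ⊢ subF ((var ∘ there ∘ there) ▸ snoc v1 v0) φ →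
          H ⊢ all φ

-- A theory in the language of HAω, given by its consequence relation.
Theory : Set₁
Theory = ∀ {Γ} → List (Formula Γ) → Formula Γ → Set

HAω : Theory
HAω = _⊢_

------------------------------------------------------------------------
-- T-definability

-- For each choice of type parameters, the defining equation is a formula
-- whose only free variable stands for the functional being specified.
record Functional : Set₁ where
  field
    Param    : Set
    type     : Param → Ty
    equation : (p : Param) → Formula (type p ∷ [])

open Functional

_≥T[_]_ : Functional → Theory → Functional → Set
F ≥T[ 𝒮 ] G =
  ∀ (p : Param G) → ∃[ p′ ] Σ[ s ∈ Tm [] (type F p′ ⇒ type G p) ]
    𝒮 {type F p′ ∷ []}
      (equation F p′ ∷ [])
      (subF ((λ ()) ▸ (closed s · v0)) (equation G p))

------------------------------------------------------------------------
-- Auxiliary terms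

𝟎 : Tm Γ A
𝟎 {A = 𝔹}     = false
𝟎 {A = ℕ}     = zero
𝟎 {A = A ⊗ B} = pair 𝟎 𝟎
𝟎 {A = A ⇒ B} = ƛ 𝟎
𝟎 {A = A ⋆}   = nil

-- m < n is decided as n ∸ m ≠ 0.
infix 6 _<_
_<_ : Tm Γ ℕ → Tm Γ ℕ → Tm Γ 𝔹
m < n = positive (natrec n (ƛ (ƛ (pred v0))) m)
  where
  pred : Tm Δ ℕ → Tm Δ ℕ
  pred = natrec zero (ƛ (ƛ v1))

  positive : Tm Δ ℕ → Tm Δ 𝔹
  positive = natrec false (ƛ (ƛ true))

len : Tm Γ (X ⋆) → Tm Γ ℕ
len = listrec zero (ƛ (ƛ (ƛ (suc v0))))

-- c ∗ α for an entry c and an infinite sequence α: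
-- (c ∗ α) 0 = c and (c ∗ α) (i + 1) = α i.
infixr 6 _∗_
_∗_ : Tm Γ X → Tm Γ (Seq X) → Tm Γ (Seq X)
c ∗ α = ƛ (ƛ (ƛ (natrec v2 (ƛ (ƛ (v3 · v1))) v0))) · c · α

-- q ↾ x is q_x = λα. q (x ∗ α).
infixl 9 _↾_
_↾_ : Tm Γ (Seq X ⇒ R) → Tm Γ X → Tm Γ (Seq X ⇒ R)
q ↾ x = ƛ (ƛ (ƛ (v2 · (v1 ∗ v0)))) · q · x

------------------------------------------------------------------------
-- The explicitly controlled products of selection functions
--
-- The bound variables of the equations are, from the outside in,
-- ε, ℓ, n (resp. s), q.

eps-type : Ty → Ty → Ty
eps-type X R = (ℕ ⇒ J R X) ⇒ (R ⇒ ℕ) ⇒ ℕ ⇒ (Seq X ⇒ R) ⇒ Seq X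

eps-equation : (X R : Ty) → Formula (eps-type X R ∷ [])
eps-equation X R = all (all (all (all (F · ε · ℓ · n · q ≐ rhs))))
  where
  Γ₄ : Ctx
  Γ₄ = (Seq X ⇒ R) ∷ ℕ ∷ (R ⇒ ℕ) ∷ (ℕ ⇒ J R X) ∷ eps-type X R ∷ []

  F : Tm Γ₄ (eps-type X R)
  F = v4

  ε : Tm Γ₄ (ℕ ⇒ J R X)
  ε = v3

  ℓ : Tm Γ₄ (R ⇒ ℕ)
  ℓ = v2

  n : Tm Γ₄ ℕ
  n = v1

  q : Tm Γ₄ (Seq X ⇒ R)
  q = v0

  c : Tm Γ₄ X
  c = ε · n · ƛ (wk q ↾ v0 · (wk F · wk ε · wk ℓ · suc (wk n) · (wk q ↾ v0)))

  rhs : Tm Γ₄ (Seq X)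
  rhs = if (ℓ · (q · 𝟎) < n) 𝟎 (c ∗ (F · ε · ℓ · suc n · (q ↾ c)))

EPS-type : Ty → Ty → Ty
EPS-type X R = (X ⋆ ⇒ J R X) ⇒ (R ⇒ ℕ) ⇒ X ⋆ ⇒ (Seq X ⇒ R) ⇒ Seq X

EPS-equation : (X R : Ty) → Formula (EPS-type X R ∷ [])
EPS-equation X R = all (all (all (all (F · ε · ℓ · s · q ≐ rhs))))
  where
  Γ₄ : Ctx
  Γ₄ = (Seq X ⇒ R) ∷ X ⋆ ∷ (R ⇒ ℕ) ∷ (X ⋆ ⇒ J R X) ∷ EPS-type X R ∷ []

  F : Tm Γ₄ (EPS-type X R)
  F = v4

  ε : Tm Γ₄ (X ⋆ ⇒ J R X)
  ε = v3

  ℓ : Tm Γ₄ (R ⇒ ℕ)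
  ℓ = v2

  s : Tm Γ₄ (X ⋆)
  s = v1

  q : Tm Γ₄ (Seq X ⇒ R)
  q = v0

  c : Tm Γ₄ X
  c = ε · s · ƛ (wk q ↾ v0 · (wk F · wk ε · wk ℓ · snoc (wk s) v0 · (wk q ↾ v0)))

  rhs : Tm Γ₄ (Seq X)
  rhs = if (ℓ · (q · 𝟎) < len s) 𝟎 (c ∗ (F · ε · ℓ · snoc s c · (q ↾ c)))

eps : Functional
eps = record
  { Param    = Ty × Ty
  ; type     = λ (X , R) → eps-type X R
  ; equation = λ (X , R) → eps-equation X R
  }

EPS : Functional
EPS = record
  { Param    = Ty × Ty
  ; type     = λ (X , R) → EPS-type X R
  ; equation = λ (X , R) → EPS-equation X R
  }

{-# OPTIONS --safe #-}

-- Run eps on the type X⋆ ⇒ X.  A sequence α of functions X⋆ ⇒ X is played out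
-- from a position s by letting α i choose the i-th entry from s and the entries
-- chosen before; call the result α^s.  Since 𝟎^s = 𝟎 and
-- (f ∗ α)^s = f s ∗ α^(s ∗ f s), the sequence
--   (eps_|s| (ε̂) (λ α. q (α^s)))^s,   where ε̂_n P s = ε_s (λ x. P (λ t. x)),
-- satisfies the defining equation of EPS_s (ε) (q): unfolding eps once is
-- enough, and no induction on the control is needed.

module Submission where

open import Data.List using (List; []; _∷_; map)
open import Data.List.Membership.Propositional using (_∈_)
open import Data.List.Relation.Unary.Any using (here; there)
open import Data.Nat as Nat using ()
open import Data.Product using (_,_)
open import Relation.Binary.PropositionalEquality
  using (_≡_; refl; sym; trans; cong; cong₂; subst)

open import Defs

infix  1 _by_
infixl 0 _⟫_

private variable
  A₀ A₁ A₂ A₃ A₄ A₅ : Ty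
  H : List (Formula Γ)

v5 : Tm (A₀ ∷ A₁ ∷ A₂ ∷ A₃ ∷ A₄ ∷ A ∷ Γ) A
v5 = wk v4

v6 : Tm (A₀ ∷ A₁ ∷ A₂ ∷ A₃ ∷ A₄ ∷ A₅ ∷ A ∷ Γ) A
v6 = wk v5

cong₃ : ∀ {a} {S T U V : Set a} (f : S → T → U → V) {x x′ y y′ z z′} →
        x ≡ x′ → y ≡ y′ → z ≡ z′ → f x y z ≡ f x′ y′ z′
cong₃ f refl refl refl = refl

-- Renaming and substitution

lifts-liftr : {ρ : Ren Γ Δ} {σ : Sub Δ Γ} →
              (∀ {B} (x : B ∈ Γ) → σ (ρ x) ≡ var x) →
              ∀ {B} (x : B ∈ A ∷ Γ) → lifts σ (liftr ρ x) ≡ var x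
lifts-liftr σρ (here refl) = refl
lifts-liftr σρ (there x)   = cong wk (σρ x)

-- Yields both cancellations used below: `wk-[]`, and `liftr-there-[v0]` under one binder, which `ξ`
-- uses.
sub-ren-id : {ρ : Ren Γ Δ} {σ : Sub Δ Γ} →
             (∀ {B} (x : B ∈ Γ) → σ (ρ x) ≡ var x) →
             (t : Tm Γ A) → sub σ (ren ρ t) ≡ t
sub-ren-id σρ (var x)         = σρ x
sub-ren-id σρ (ƛ t)           = cong ƛ (sub-ren-id (lifts-liftr σρ) t)
sub-ren-id σρ (t · u)         = cong₂ _·_ (sub-ren-id σρ t) (sub-ren-id σρ u)
sub-ren-id σρ (pair t u)      = cong₂ pair (sub-ren-id σρ t) (sub-ren-id σρ u)
sub-ren-id σρ (fst t)         = cong fst (sub-ren-id σρ t)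
sub-ren-id σρ (snd t)         = cong snd (sub-ren-id σρ t)
sub-ren-id σρ true            = refl
sub-ren-id σρ false           = refl
sub-ren-id σρ (if b t u)      =
  cong₃ if (sub-ren-id σρ b) (sub-ren-id σρ t) (sub-ren-id σρ u)
sub-ren-id σρ zero            = refl
sub-ren-id σρ (suc t)         = cong suc (sub-ren-id σρ t)
sub-ren-id σρ (natrec a f n)  =
  cong₃ natrec (sub-ren-id σρ a) (sub-ren-id σρ f) (sub-ren-id σρ n)
sub-ren-id σρ nil             = refl
sub-ren-id σρ (snoc s t)      = cong₂ snoc (sub-ren-id σρ s) (sub-ren-id σρ t)
sub-ren-id σρ (listrec b f s) =
  cong₃ listrec (sub-ren-id σρ b) (sub-ren-id σρ f) (sub-ren-id σρ s)

wk-[] : (t : Tm Γ A) {u : Tm Γ B} → wk t [ u ] ≡ t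
wk-[] t = sub-ren-id (λ _ → refl) t

liftr-there-[v0] : (t : Tm (A ∷ Γ) B) → ren (liftr there) t [ v0 ] ≡ t
liftr-there-[v0] = sub-ren-id λ { (here refl) → refl ; (there x) → refl }

ren-𝟎 : ∀ A {ρ : Ren Γ Δ} → ren ρ (𝟎 {A = A}) ≡ 𝟎
ren-𝟎 𝔹       = refl
ren-𝟎 ℕ       = refl
ren-𝟎 (A ⊗ B) = cong₂ pair (ren-𝟎 A) (ren-𝟎 B)
ren-𝟎 (A ⇒ B) = cong ƛ (ren-𝟎 B)
ren-𝟎 (A ⋆)   = refl

sub-𝟎 : ∀ A {σ : Sub Γ Δ} → sub σ (𝟎 {A = A}) ≡ 𝟎
sub-𝟎 𝔹       = refl
sub-𝟎 ℕ       = refl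
sub-𝟎 (A ⊗ B) = cong₂ pair (sub-𝟎 A) (sub-𝟎 B)
sub-𝟎 (A ⇒ B) = cong ƛ (sub-𝟎 B)
sub-𝟎 (A ⋆)   = refl

-- Equality in HAω

≐-sym : {t u : Tm Γ A} → H ⊢ t ≐ u → H ⊢ u ≐ t
≐-sym {H = H} {t = t} {u} t≐u =
  subst (λ t′ → H ⊢ u ≐ t′) (wk-[] t)
    (≐-subst (v0 ≐ wk t) t≐u
      (subst (λ t′ → H ⊢ t ≐ t′) (sym (wk-[] t)) ≐-refl))

≐-trans : {t u v : Tm Γ A} → H ⊢ t ≐ u → H ⊢ u ≐ v → H ⊢ t ≐ v
≐-trans {H = H} {t = t} {u} {v} t≐u u≐v =
  subst (λ t′ → H ⊢ t′ ≐ v) (wk-[] t)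
    (≐-subst (wk t ≐ v0) u≐v
      (subst (λ t′ → H ⊢ t′ ≐ u) (sym (wk-[] t)) t≐u))

≐-cong : (C : Tm (A ∷ Γ) B) {t u : Tm Γ A} {t′ u′ : Tm Γ B} →
         C [ t ] ≡ t′ → C [ u ] ≡ u′ → H ⊢ t ≐ u → H ⊢ t′ ≐ u′
≐-cong {H = H} C {t} {u} refl refl t≐u =
  subst (λ s → H ⊢ s ≐ C [ u ]) (wk-[] (C [ t ]))
    (≐-subst (wk (C [ t ]) ≐ C) t≐u
      (subst (λ s → H ⊢ s ≐ C [ t ]) (sym (wk-[] (C [ t ]))) ≐-refl))

·-congˡ : {f g : Tm Γ (A ⇒ B)} {t : Tm Γ A} → H ⊢ f ≐ g → H ⊢ f · t ≐ g · t
·-congˡ {f = f} {g} {t} =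
  ≐-cong (v0 · wk t) (cong (f ·_) (wk-[] t)) (cong (g ·_) (wk-[] t))

·-congʳ : {f : Tm Γ (A ⇒ B)} {t u : Tm Γ A} → H ⊢ t ≐ u → H ⊢ f · t ≐ f · u
·-congʳ {f = f} {t} {u} =
  ≐-cong (wk f · v0) (cong (_· t) (wk-[] f)) (cong (_· u) (wk-[] f))

·-cong : {f g : Tm Γ (A ⇒ B)} {t u : Tm Γ A} →
         H ⊢ f ≐ g → H ⊢ t ≐ u → H ⊢ f · t ≐ g · u
·-cong f≐g t≐u = ≐-trans (·-congˡ f≐g) (·-congʳ t≐u)

suc-cong : {m n : Tm Γ ℕ} → H ⊢ m ≐ n → H ⊢ suc m ≐ suc n
suc-cong = ≐-cong (suc v0) refl refl

snoc-cong : {s t : Tm Γ (A ⋆)} {x y : Tm Γ A} →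
            H ⊢ s ≐ t → H ⊢ x ≐ y → H ⊢ snoc s x ≐ snoc t y
snoc-cong {s = s} {t} {x} {y} s≐t x≐y = ≐-trans
  (≐-cong (snoc v0 (wk x)) (cong (snoc s) (wk-[] x)) (cong (snoc t) (wk-[] x)) s≐t)
  (≐-cong (snoc (wk t) v0)
    (cong (λ r → snoc r x) (wk-[] t)) (cong (λ r → snoc r y) (wk-[] t)) x≐y)

natrec-cong : {a b : Tm Γ A} {f g : Tm Γ (ℕ ⇒ A ⇒ A)} {m n : Tm Γ ℕ} →
              H ⊢ a ≐ b → H ⊢ f ≐ g → H ⊢ m ≐ n → H ⊢ natrec a f m ≐ natrec b g n
natrec-cong {a = a} {b} {f} {g} {m} {n} a≐b f≐g m≐n = ≐-trans
  (≐-cong (natrec v0 (wk f) (wk m))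
    (cong₂ (natrec a) (wk-[] f) (wk-[] m)) (cong₂ (natrec b) (wk-[] f) (wk-[] m)) a≐b)
  (≐-trans
    (≐-cong (natrec (wk b) v0 (wk m))
      (cong₂ (λ b → natrec b f) (wk-[] b) (wk-[] m))
      (cong₂ (λ b → natrec b g) (wk-[] b) (wk-[] m)) f≐g)
    (≐-cong (natrec (wk b) (wk g) v0)
      (cong₂ (λ b g → natrec b g m) (wk-[] b) (wk-[] g))
      (cong₂ (λ b g → natrec b g n) (wk-[] b) (wk-[] g)) m≐n))

listrec-cong : {b c : Tm Γ B} {f g : Tm Γ (A ⋆ ⇒ A ⇒ B ⇒ B)} {s t : Tm Γ (A ⋆)} →
               H ⊢ b ≐ c → H ⊢ f ≐ g → H ⊢ s ≐ t → H ⊢ listrec b f s ≐ listrec c g t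
listrec-cong {b = b} {c} {f} {g} {s} {t} b≐c f≐g s≐t = ≐-trans
  (≐-cong (listrec v0 (wk f) (wk s))
    (cong₂ (listrec b) (wk-[] f) (wk-[] s)) (cong₂ (listrec c) (wk-[] f) (wk-[] s)) b≐c)
  (≐-trans
    (≐-cong (listrec (wk c) v0 (wk s))
      (cong₂ (λ c → listrec c f) (wk-[] c) (wk-[] s))
      (cong₂ (λ c → listrec c g) (wk-[] c) (wk-[] s)) f≐g)
    (≐-cong (listrec (wk c) (wk g) v0)
      (cong₂ (λ c g → listrec c g s) (wk-[] c) (wk-[] g))
      (cong₂ (λ c g → listrec c g t) (wk-[] c) (wk-[] g)) s≐t))

if-cong : {b c : Tm Γ 𝔹} {t t′ u u′ : Tm Γ A} →
          H ⊢ b ≐ c → H ⊢ t ≐ t′ → H ⊢ u ≐ u′ → H ⊢ if b t u ≐ if c t′ u′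
if-cong {b = b} {c} {t} {t′} {u} {u′} b≐c t≐t′ u≐u′ = ≐-trans
  (≐-cong (if v0 (wk t) (wk u))
    (cong₂ (if b) (wk-[] t) (wk-[] u)) (cong₂ (if c) (wk-[] t) (wk-[] u)) b≐c)
  (≐-trans
    (≐-cong (if (wk c) v0 (wk u))
      (cong₂ (λ c → if c t) (wk-[] c) (wk-[] u))
      (cong₂ (λ c → if c t′) (wk-[] c) (wk-[] u)) t≐t′)
    (≐-cong (if (wk c) (wk t′) v0)
      (cong₂ (λ c t → if c t u) (wk-[] c) (wk-[] t′))
      (cong₂ (λ c t → if c t u′) (wk-[] c) (wk-[] t′)) u≐u′))

ξ : {t u : Tm (A ∷ Γ) B} → map wkF H ⊢ t ≐ u → H ⊢ ƛ t ≐ ƛ u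
ξ {t = t} {u} t≐u = ext (∀I (≐-trans (β-wk t) (≐-trans t≐u (≐-sym (β-wk u)))))
  where
  β-wk : {H : List (Formula (A ∷ Γ))} (t : Tm (A ∷ Γ) B) → H ⊢ wk (ƛ t) · v0 ≐ t
  β-wk {H = H} t = subst (λ t′ → H ⊢ wk (ƛ t) · v0 ≐ t′) (liftr-there-[v0] t) β

-- Case distinction on the boolean: for an open term `b`, conversion cannot choose a branch.
·-if : (f : Tm Γ (A ⇒ B)) (b : Tm Γ 𝔹) (t u : Tm Γ A) →
       H ⊢ f · if b t u ≐ if b (f · t) (f · u)
·-if {H = H} f b t u = subst (H ⊢_) (at b) (∀E (𝔹-ind φ
  (subst (H ⊢_) (sym (at true)) (≐-trans (·-congʳ if-true) (≐-sym if-true)))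
  (subst (H ⊢_) (sym (at false)) (≐-trans (·-congʳ if-false) (≐-sym if-false)))) b)
  where
  φ = wk f · if v0 (wk t) (wk u) ≐ if v0 (wk f · wk t) (wk f · wk u)

  at : ∀ b → φ [ b ]F ≡ (f · if b t u ≐ if b (f · t) (f · u))
  at b = cong₃ (λ f t u → f · if b t u ≐ if b (f · t) (f · u))
    (wk-[] f) (wk-[] t) (wk-[] u)

-- Conversion by evaluation
--
-- Only object variables may stand for unknown terms here: evaluation is stuck
-- on an Agda variable and on 𝟎 at an unknown type.

record Reduct (t : Tm Γ A) : Set where
  constructor _by_
  field
    term  : Tm Γ A
    -- Uniform in `H`, since `ξ` passes from `H` to `map wkF H`.
    equal : ∀ {H} → H ⊢ t ≐ term

open Reduct

_⟫_ : {t : Tm Γ A} (r : Reduct t) → Reduct (term r) → Reduct t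
r ⟫ r′ = term r′ by ≐-trans (equal r) (equal r′)

contract : (t : Tm Γ A) → Reduct t
contract (ƛ t · u)                = t [ u ] by β
contract (natrec a f zero)        = a by natrec-zero
contract (natrec a f (suc n))     = f · n · natrec a f n by natrec-suc
contract (listrec b f nil)        = b by listrec-nil
contract (listrec b f (snoc s x)) = f · s · x · listrec b f s by listrec-snoc
contract t                        = t by ≐-refl

-- One pass from the leaves up, with at most one contraction per node; redexes inside a contractum
-- may have to wait for the next pass, whence the count in `reduces`.
reduce : (t : Tm Γ A) → Reduct t
reduce (ƛ t) = ƛ (term t′) by ξ (equal t′)
  where t′ = reduce t
reduce (t · u) = (term t′ · term u′ by ·-cong (equal t′) (equal u′)) ⟫ contract _
  where t′ = reduce t
        u′ = reduce u
reduce (suc n) = suc (term n′) by suc-cong (equal n′)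
  where n′ = reduce n
reduce (snoc s x) = snoc (term s′) (term x′) by snoc-cong (equal s′) (equal x′)
  where s′ = reduce s
        x′ = reduce x
reduce (natrec a f n) =
  (natrec (term a′) (term f′) (term n′) by
    natrec-cong (equal a′) (equal f′) (equal n′)) ⟫ contract _
  where a′ = reduce a
        f′ = reduce f
        n′ = reduce n
reduce (listrec b f s) =
  (listrec (term b′) (term f′) (term s′) by
    listrec-cong (equal b′) (equal f′) (equal s′)) ⟫ contract _
  where b′ = reduce b
        f′ = reduce f
        s′ = reduce s
reduce t = t by ≐-refl

reduces : Nat.ℕ → (t : Tm Γ A) → Reduct t
reduces Nat.zero    t = t by ≐-refl
reduces (Nat.suc k) t = reduce t ⟫ reduces k _

by-reduction : ∀ k {t u : Tm Γ A} → term (reduces k t) ≡ term (reduces k u) → H ⊢ t ≐ u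
by-reduction {H = H} k {t} {u} t≡u = ≐-trans (equal (reduces k t))
  (subst (λ v → H ⊢ v ≐ u) (sym t≡u) (≐-sym (equal (reduces k u))))

-- Conversion cannot use an induction hypothesis or an earlier lemma; one such equation acts here at
-- the hole `v0` of `C`, between two conversions.
by-rewriting : ∀ k (C : Tm (A ∷ Γ) B) {t u : Tm Γ A} {t′ u′ : Tm Γ B} → H ⊢ t ≐ u →
               term (reduces k t′) ≡ term (reduces k (C [ t ])) →
               term (reduces k (C [ u ])) ≡ term (reduces k u′) → H ⊢ t′ ≐ u′
by-rewriting k C t≐u p q =
  ≐-trans (by-reduction k p) (≐-trans (≐-cong C refl refl t≐u) (by-reduction k q))

-- Plays of sequences of strategies

Strategies : Ty → Ty
Strategies X = Seq (X ⋆ ⇒ X)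

-- The position before move `n`. It begins with `s`, so every strategy reads the whole history.
play-prefix : Tm Γ (X ⋆ ⇒ Strategies X ⇒ ℕ ⇒ X ⋆)
play-prefix = ƛ (ƛ (ƛ (natrec v2 (ƛ (ƛ (snoc v0 (v3 · v1 · v0)))) v0)))

-- play · s · α is α^s.
play : Tm Γ (X ⋆ ⇒ Strategies X ⇒ Seq X)
play = ƛ (ƛ (ƛ (v1 · v0 · (play-prefix · v2 · v1 · v0))))

-- A constant strategy ignores the position. Its value is first a variable, so that evaluation can
-- run; `𝟎` is put in afterwards.
play-𝟎 : (s : Tm Γ (X ⋆)) → H ⊢ play · s · 𝟎 ≐ 𝟎
play-𝟎 {X = X} {H = H} s = subst (H ⊢_)
  (cong₃ (λ s z z′ → play · s · ƛ (ƛ z) ≐ ƛ z′)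
    (wk-[] s) (trans (cong wk (ren-𝟎 X)) (ren-𝟎 X)) (ren-𝟎 X))
  (∀E (∀E play-const s) 𝟎)
  where
  play-const : H ⊢ all {A = X ⋆} (all (play · v1 · ƛ (ƛ v2) ≐ ƛ v1))
  play-const = ∀I (∀I (by-reduction 10 refl))

-- The first move `v3 · v4` is absorbed into the starting position; after it both sides append the
-- same moves. The context is that of the successor case in `play-∗`.
play-prefix-∗ : {H : List (Formula (A ∷ Strategies X ∷ (X ⋆ ⇒ X) ∷ X ⋆ ∷ Γ))} →
                H ⊢ all (play-prefix · v4 · (v3 ∗ v2) · suc v0
                          ≐ play-prefix · snoc v4 (v3 · v4) · v2 · v0)
play-prefix-∗ = ℕ-ind _ (by-reduction 10 refl)
  (by-rewriting 10 (snoc v0 (v3 · v1 · v0)) (hyp (here refl)) refl refl)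

-- Entry 0 computes; at a successor both sides apply the same strategy to positions that
-- `play-prefix-∗` identifies.
play-∗ : H ⊢ all {A = X ⋆} (all {A = X ⋆ ⇒ X} (all
           (play · v2 · (v1 ∗ v0) ≐ v1 · v2 ∗ play · snoc v2 (v1 · v2) · v0)))
play-∗ = ∀I (∀I (∀I (ext (ℕ-ind _ (by-reduction 10 refl)
  (by-rewriting 10 (v2 · v1 · v0) (∀E play-prefix-∗ v0) refl refl)))))

-- Outcome functions and selection functions on strategies

payoff : Tm Γ ((Seq X ⇒ R) ⇒ X ⋆ ⇒ Strategies X ⇒ R)
payoff = ƛ (ƛ (ƛ (v2 · (play · v1 · v0))))

payoff-play : H ⊢ all {A = Seq X ⇒ R} (all (all
                (payoff · v2 · v1 · v0 ≐ v2 · (play · v1 · v0))))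
payoff-play = ∀I (∀I (∀I (by-reduction 10 refl)))

-- This is `play-∗` under `q`. It brings the argument of a recursive call of `eps` into the form
-- that `EPS-from-eps` has at the extended position.
payoff-↾ : H ⊢ all {A = Seq X ⇒ R} (all (all
             (payoff · v2 · v1 ↾ v0 ≐ payoff · (v2 ↾ (v0 · v1)) · snoc v1 (v0 · v1))))
payoff-↾ = ∀I (∀I (∀I (ext (∀I
  (by-rewriting 10 (v4 · v0) (∀E (∀E (∀E play-∗ v2) v1) v0) refl refl)))))

-- `simple` tries only constant strategies, which play their value from any position. Both sides are
-- abstractions because a rewritten term cannot mention a variable bound in `C`.
payoff-↾-const : H ⊢ all {A = Seq X ⇒ R} (all
                   (ƛ (payoff · v2 · v1 ↾ ƛ v1) ≐ ƛ (payoff · (v2 ↾ v0) · snoc v1 v0)))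
payoff-↾-const = ∀I (∀I (ξ
  (by-rewriting 10 v0 (∀E (∀E (∀E payoff-↾ v2) v1) (ƛ v1)) refl refl)))

-- ε̂ = simple · ε
simple : Tm Γ ((X ⋆ ⇒ J R X) ⇒ ℕ ⇒ J R (X ⋆ ⇒ X))
simple = ƛ (ƛ (ƛ (ƛ (v3 · v0 · ƛ (v2 · ƛ v1)))))

EPS-from-eps : Tm Γ (eps-type (X ⋆ ⇒ X) R ⇒ EPS-type X R)
EPS-from-eps =
  ƛ (ƛ (ƛ (ƛ (ƛ (play · v1 · (v4 · (simple · v3) · v2 · len v1 · (payoff · v0 · v1)))))))

-- One unfolding of the product

module _ {X R : Ty} where

  Γ₅ : Ctx
  Γ₅ = (Seq X ⇒ R) ∷ X ⋆ ∷ (R ⇒ ℕ) ∷ (X ⋆ ⇒ J R X) ∷ eps-type (X ⋆ ⇒ X) R ∷ []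

  F : Tm Γ₅ (eps-type (X ⋆ ⇒ X) R)
  F = v4

  ε : Tm Γ₅ (X ⋆ ⇒ J R X)
  ε = v3

  ℓ : Tm Γ₅ (R ⇒ ℕ)
  ℓ = v2

  s : Tm Γ₅ (X ⋆)
  s = v1

  q : Tm Γ₅ (Seq X ⇒ R)
  q = v0

  ĉ : Tm Γ₅ (X ⋆ ⇒ X)
  ĉ = simple · ε · len s · ƛ (payoff · wk q · wk s ↾ v0
    · (wk F · (simple · wk ε) · wk ℓ · suc (len (wk s)) · (payoff · wk q · wk s ↾ v0)))

  c : Tm Γ₅ X
  c = ε · s · ƛ (wk q ↾ v0
    · (EPS-from-eps · wk F · wk ε · wk ℓ · snoc (wk s) v0 · (wk q ↾ v0)))

  -- The zero sequence is a parameter because the instantiated equation contains a renamed and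
  -- substituted `𝟎`, which has to be transported to `𝟎`.
  eps-unfolding : Tm Γ₅ (Strategies X) → Formula Γ₅
  eps-unfolding z =
    F · (simple · ε) · ℓ · len s · (payoff · q · s)
      ≐ if (ℓ · (payoff · q · s · z) < len s) z
           (ĉ ∗ F · (simple · ε) · ℓ · suc (len s) · (payoff · q · s ↾ ĉ))

  EPS-unfolding : Tm Γ₅ (Seq X) → Formula Γ₅
  EPS-unfolding z =
    EPS-from-eps · F · ε · ℓ · s · q
      ≐ if (ℓ · (q · z) < len s) z
           (c ∗ EPS-from-eps · F · ε · ℓ · snoc s c · (q ↾ c))

  -- On `s`, `ĉ` evaluates the outcome at constant strategies, hence `payoff-↾-const`; the indices
  -- then agree because `len (snoc s x)` converts to `suc (len s)`.
  ĉ-≐ : {H : List (Formula Γ₅)} → H ⊢ ĉ · s ≐ c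
  ĉ-≐ = by-rewriting 12
    (wk ε · wk s · ƛ (v1 · v0
      · (v6 · (simple · v5) · v4 · suc (len v3) · (v1 · v0))))
    (∀E (∀E payoff-↾-const q) s) refl refl

  -- The first strategy is a variable, later instantiated with `ĉ`, so that conversion leaves it
  -- intact.
  play-∗-eps : {H : List (Formula Γ₅)} → H ⊢ all
    (play · wk s · (v0 ∗ wk F · (simple · wk ε) · wk ℓ · suc (len (wk s))
                          · (payoff · wk q · wk s ↾ v0))
      ≐ v0 · wk s ∗ EPS-from-eps · wk F · wk ε · wk ℓ · snoc (wk s) (v0 · wk s)
                      · (wk q ↾ (v0 · wk s)))
  play-∗-eps = ∀I (≐-trans
    (∀E (∀E (∀E play-∗ v2) v0)
      (v5 · (simple · v4) · v3 · suc (len v2) · (payoff · v1 · v2 ↾ v0)))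
    (by-rewriting 12
      (v1 · v3 ∗ play · snoc v3 (v1 · v3) · (v6 · (simple · v5) · v4 · suc (len v3) · v0))
      (∀E (∀E (∀E payoff-↾ v1) v2) v0) refl refl))

  EPS-unfold : {H : List (Formula Γ₅)} → H ⊢ eps-unfolding 𝟎 → H ⊢ EPS-unfolding 𝟎
  EPS-unfold eps-unfold =
    ≐-trans (by-reduction 10 refl)
    (≐-trans (·-congʳ eps-unfold)
    (≐-trans (·-if (play · s) _ _ _)
    (if-cong
      -- The stopping tests agree: the play of `𝟎` is `𝟎`, and `eps` starts at index `len s`.
      (≐-cong (wk ℓ · v0 < len (wk s)) refl refl
        (≐-trans (∀E (∀E (∀E payoff-play q) s) 𝟎) (·-congʳ (play-𝟎 s))))
      (play-𝟎 s)
      (≐-trans (∀E play-∗-eps ĉ)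
        -- `ĉ · s` becomes `c` in all three places: the head, the extended position and the residual
        -- outcome function.
        (≐-cong (v0 ∗ EPS-from-eps · wk F · wk ε · wk ℓ · snoc (wk s) v0 · (wk q ↾ v0))
          refl refl ĉ-≐)))))

theorem3p13 : eps ≥T[ HAω ] EPS
theorem3p13 (X , R) = (X ⋆ ⇒ X , R) , EPS-from-eps , ∀I (∀I (∀I (∀I
  (subst (λ z → H₄ ⊢ EPS-unfolding z) (sym (sub-𝟎 (Seq X)))
    (EPS-unfold (subst (λ z → H₄ ⊢ eps-unfolding z)
      -- One renaming for each ∀I and one substitution for each ∀E.
      (sub-𝟎′ (sub-𝟎′ (sub-𝟎′ (sub-𝟎′ (ren-𝟎′ (ren-𝟎′ (ren-𝟎′ (ren-𝟎′ refl))))))))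
      (∀E (∀E (∀E (∀E (hyp (here refl)) (simple · ε)) ℓ) (len s)) (payoff · q · s))))))))
  where
  H₄ : List (Formula (Γ₅ {X} {R}))
  H₄ = map wkF (map wkF (map wkF (map wkF (eps-equation (X ⋆ ⇒ X) R ∷ []))))

  ren-𝟎′ : ∀ {Γ Δ} {ρ : Ren Γ Δ} {t} → t ≡ 𝟎 → ren ρ t ≡ 𝟎 {A = Strategies X}
  ren-𝟎′ refl = ren-𝟎 (Strategies X)

  sub-𝟎′ : ∀ {Γ Δ} {σ : Sub Γ Δ} {t} → t ≡ 𝟎 → sub σ t ≡ 𝟎 {A = Strategies X}
  sub-𝟎′ refl = sub-𝟎 (Strategies X)
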